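{- For all integers $m \geq n \geq 8$, $DD_{\mathrm{m}}(P_m \,\square\, P_n) \leq \left\lfloor \frac{(n+2)(m+3)}{5}\right\rfloor$.
   Context: $P_k$ is the path on $k$ vertices. $G\,\square\,H$ denotes the Cartesian product: vertex set $V(G)\times V(H)$, with $(a,b)$ and $(c,d)$ adjacent iff $a=c$ and $bd\in E(H)$, or $ac\in E(G)$ and $b=d$; thus $P_m\,\square\,P_n$ is the $m\times n$ grid graph. Swap number: a dominating set $D$ of a graph $G$ is a swap set if there is a dominating set $D'$ of $G$ with $D\cap D'=\emptyset$, $|D|=|D'|$, such that $G$ contains a perfect matching between $D$ and $D'$ (a bijection $f:D\to D'$ with $x f(x)\in E(G)$ for all $x\in D$). $DD_{\mathrm{m}}(G)$ is the minimum cardinality of a swap set of $G$, and $DD_{\mathrm{m}}(G)=\infty$ if none exists. -}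

module Defs where

open import Data.Fin.Base using (Fin; toℕ; quotient; remainder; finToFun; funToFin)
open import Data.Fin.Properties using (any?; all?; finToFun-funToFin) renaming (_≟_ to _≟ᶠ_)
open import Data.Fin.Subset using (Subset; _∈_; _∩_; ∣_∣; Empty)
open import Data.Fin.Subset.Properties using (_∈?_; nonempty?; anySubset?; ∣p∣≤n)
open import Data.Nat.Base using (ℕ; zero; suc; _*_; _≤_; _<_; z≤n)
open import Data.Nat.Properties using (_≟_; 1+n≢n; m≤n⇒m<n∨m≡n; <⇒≱)
open import Data.Product.Base using (Σ; ∃; ∃-syntax; _×_; _,_; proj₁; proj₂)
open import Data.Sum.Base using (_⊎_; inj₁; inj₂; swap)
open import Data.Vec.Properties.WithK using ([]=-irrelevant)
open import Function.Base using (_∘_)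
open import Function.Bundles using (_⤖_; mk⤖; module Bijection)
open import Relation.Binary.Definitions using (Decidable; Symmetric)
open import Relation.Binary.PropositionalEquality using (_≡_; refl; sym; trans; cong; subst)
open import Relation.Nullary using (¬_; Dec; yes; no; contradiction; _×-dec_; _⊎-dec_; _→-dec_; ¬?)
open import Relation.Nullary.Construct.Add.Supremum using (_⁺; ⊤⁺; [_])
open import Relation.Nullary.Decidable using (map′)
import Relation.Binary.Construct.Add.Supremum.NonStrict as Supremum

-- Finite simple graphs on the vertex set Fin n.
record Graph (n : ℕ) : Set₁ where
  field
    Adj    : Fin n → Fin n → Set
    adj?   : Decidable Adj
    symm   : Symmetric Adj
    irrefl : ∀ v → ¬ Adj v v

open Graph public

P : (k : ℕ) → Graph k
P k = record
  { Adj    = λ i j → suc (toℕ i) ≡ toℕ j ⊎ suc (toℕ j) ≡ toℕ i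
  ; adj?   = λ i j → (suc (toℕ i) ≟ toℕ j) ⊎-dec (suc (toℕ j) ≟ toℕ i)
  ; symm   = swap
  ; irrefl = λ { v (inj₁ e) → 1+n≢n e ; v (inj₂ e) → 1+n≢n e }
  }

-- The vertex x : Fin (m * n) stands for the pair (quotient n x , remainder n x)
-- in Fin m × Fin n; see Data.Fin.Properties.*↔×.
infixr 7 _□_
_□_ : ∀ {m n} → Graph m → Graph n → Graph (m * n)
_□_ {m} {n} G H = record
  { Adj    = λ x y → (fst x ≡ fst y × Adj H (snd x) (snd y))
                   ⊎ (Adj G (fst x) (fst y) × snd x ≡ snd y)
  ; adj?   = λ x y → ((fst x ≟ᶠ fst y) ×-dec adj? H (snd x) (snd y))
                   ⊎-dec (adj? G (fst x) (fst y) ×-dec (snd x ≟ᶠ snd y))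
  ; symm   = λ { (inj₁ (e , a)) → inj₁ (sym e , symm H a)
               ; (inj₂ (a , e)) → inj₂ (symm G a , sym e) }
  ; irrefl = λ { x (inj₁ (_ , a)) → irrefl H (snd x) a
               ; x (inj₂ (a , _)) → irrefl G (fst x) a }
  }
  where
  fst : Fin (m * n) → Fin m
  fst = quotient n
  snd : Fin (m * n) → Fin n
  snd = remainder {m} n

module _ {n : ℕ} (G : Graph n) where

  IsDominating : Subset n → Set
  IsDominating D = ∀ v → v ∈ D ⊎ ∃[ u ] u ∈ D × Adj G u v

  Elem : Subset n → Set
  Elem D = ∃[ v ] v ∈ D

  PerfectMatching : Subset n → Subset n → Set
  PerfectMatching D D′ =
    Σ (Elem D ⤖ Elem D′) λ f → ∀ x → Adj G (proj₁ x) (proj₁ (Bijection.to f x))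

  IsSwapSet : Subset n → Set
  IsSwapSet D = IsDominating D ×
    ∃[ D′ ] IsDominating D′ × Empty (D ∩ D′) × ∣ D ∣ ≡ ∣ D′ ∣ × PerfectMatching D D′

  -- d is the minimum cardinality of a swap set, ⊤⁺ being ∞.
  IsSwapNumber : ℕ ⁺ → Set
  IsSwapNumber [ k ] = (∃[ D ] IsSwapSet D × ∣ D ∣ ≡ k) × (∀ D → IsSwapSet D → k ≤ ∣ D ∣)
  IsSwapNumber ⊤⁺    = ∀ D → ¬ IsSwapSet D

  dominating? : ∀ D → Dec (IsDominating D)
  dominating? D = all? λ v → (v ∈? D) ⊎-dec any? λ u → (u ∈? D) ×-dec adj? G u v

  private
    -- Perfect matchings presented by total functions on Fin n, which can be enumerated.
    IsMatching : Subset n → Subset n → (Fin n → Fin n) → Set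
    IsMatching D D′ h =
        (∀ x → x ∈ D → h x ∈ D′ × Adj G x (h x))
      × (∀ x y → x ∈ D → y ∈ D → h x ≡ h y → x ≡ y)
      × (∀ y → y ∈ D′ → ∃[ x ] x ∈ D × h x ≡ y)

    isMatching? : ∀ D D′ h → Dec (IsMatching D D′ h)
    isMatching? D D′ h =
      (all? λ x → (x ∈? D) →-dec ((h x ∈? D′) ×-dec adj? G x (h x)))
      ×-dec (all? λ x → all? λ y → (x ∈? D) →-dec ((y ∈? D) →-dec ((h x ≟ᶠ h y) →-dec (x ≟ᶠ y))))
      ×-dec (all? λ y → (y ∈? D′) →-dec any? λ x → (x ∈? D) ×-dec (h x ≟ᶠ y))

    IsMatching-resp : ∀ {D D′ h h′} → (∀ x → h x ≡ h′ x) → IsMatching D D′ h → IsMatching D D′ h′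
    IsMatching-resp {D′ = D′} eq (a , b , c) =
        (λ x p → subst (_∈ D′) (eq x) (proj₁ (a x p)) , subst (Adj G x) (eq x) (proj₂ (a x p)))
      , (λ x y p q e → b x y p q (trans (eq x) (trans e (sym (eq y)))))
      , (λ y q → let (x , p , e) = c y q in x , p , trans (sym (eq x)) e)

    Elem-≡ : ∀ {D} {x y : Elem D} → proj₁ x ≡ proj₁ y → x ≡ y
    Elem-≡ {x = x , p} {_ , q} refl = cong (x ,_) ([]=-irrelevant p q)

    toMatching : ∀ D D′ {h} → IsMatching D D′ h → PerfectMatching D D′
    toMatching D D′ {h} (a , b , c) = mk⤖ {to = to} (inj , surj) , λ (x , p) → proj₂ (a x p)
      where
      to : Elem D → Elem D′
      to (x , p) = h x , proj₁ (a x p)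
      inj : ∀ {x y} → to x ≡ to y → x ≡ y
      inj {x , p} {y , q} e = Elem-≡ (b x y p q (cong proj₁ e))
      surj : ∀ y → ∃[ x ] (∀ {z} → z ≡ x → to z ≡ y)
      surj (y , q) = let (x , p , e) = c y q in (x , p) , λ { refl → Elem-≡ e }

    fromMatching : ∀ D D′ → PerfectMatching D D′ → ∃ (IsMatching D D′)
    fromMatching D D′ (f , adj) = h , a , b , c
      where
      open Bijection f using (to; injective; surjective)
      h : Fin n → Fin n
      h x with x ∈? D
      ... | yes p = proj₁ (to (x , p))
      ... | no  _ = x
      h-∈ : ∀ x p → h x ≡ proj₁ (to (x , p))
      h-∈ x p with x ∈? D
      ... | yes q = cong (λ r → proj₁ (to (x , r))) ([]=-irrelevant q p)
      ... | no ¬q = contradiction p ¬q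
      a : ∀ x → x ∈ D → h x ∈ D′ × Adj G x (h x)
      a x p = subst (_∈ D′) (sym (h-∈ x p)) (proj₂ (to (x , p)))
            , subst (Adj G x) (sym (h-∈ x p)) (adj (x , p))
      b : ∀ x y → x ∈ D → y ∈ D → h x ≡ h y → x ≡ y
      b x y p q e = cong proj₁ (injective (Elem-≡ (trans (sym (h-∈ x p)) (trans e (h-∈ y q)))))
      c : ∀ y → y ∈ D′ → ∃[ x ] x ∈ D × h x ≡ y
      c y q = let ((x , p) , e) = surjective (y , q) in x , p , trans (h-∈ x p) (cong proj₁ (e refl))

  perfectMatching? : ∀ D D′ → Dec (PerfectMatching D D′)
  perfectMatching? D D′ = map′
    (λ (_ , m) → toMatching D D′ m)
    (λ pm → let (h , m) = fromMatching D D′ pm in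
            funToFin h , IsMatching-resp (sym ∘ finToFun-funToFin h) m)
    (any? λ i → isMatching? D D′ (finToFun i))

  swapSet? : ∀ D → Dec (IsSwapSet D)
  swapSet? D = dominating? D ×-dec anySubset? λ D′ →
    dominating? D′ ×-dec ¬? (nonempty? (D ∩ D′)) ×-dec (∣ D ∣ ≟ ∣ D′ ∣) ×-dec perfectMatching? D D′

  private
    search : ∀ k → ∃ IsSwapNumber ⊎ (∀ D → IsSwapSet D → k ≤ ∣ D ∣)
    search zero = inj₂ λ _ _ → z≤n
    search (suc k) with search k
    ... | inj₁ found = inj₁ found
    ... | inj₂ below with anySubset? (λ D → swapSet? D ×-dec (∣ D ∣ ≟ k))
    ...   | yes w = inj₁ ([ k ] , w , below)
    ...   | no ¬w = inj₂ above
      where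
      above : ∀ D → IsSwapSet D → k < ∣ D ∣
      above D s with m≤n⇒m<n∨m≡n (below D s)
      ... | inj₁ lt = lt
      ... | inj₂ eq = contradiction (D , s , sym eq) ¬w

  swapNumber : ∃ IsSwapNumber
  swapNumber with search (suc n)
  ... | inj₁ found = found
  ... | inj₂ none  = ⊤⁺ , λ D s → <⇒≱ (none D s) (∣p∣≤n D)

  DDₘ : ℕ ⁺
  DDₘ = proj₁ swapNumber

open Supremum _≤_ public using (_≤⁺_)

{-# OPTIONS --safe #-}

-- In ℤ² put a vertex (x , y) into D if x + 2y ≡ c and into E if x + 2y ≡ c + 1 (mod 5).
-- Both are perfect codes, and they are matched by horizontal edges ("dominoes").
-- A domino contributes to dominating the m × n grid only if its left half lies in an
-- (m + 3) × (n + 2) box, and over the five offsets c these dominoes number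
-- (m + 3)(n + 2) in total.  Dominoes sticking out of the grid are pushed inside; the few
-- that would collide near the corners are superfluous or have room for a shift.
-- The resulting cell contents depend only on the residue of x + 2y - c and on the
-- distances to the border up to 4, so that domination and matching are finite checks;
-- the best of the five offsets gives the bound.

module Submission where

open import Defs
import Algebra.Properties.CommutativeMonoid.Sum
open import Data.Bool.Base using (Bool; true; false; not)
open import Data.Bool.Properties using () renaming (_≟_ to _≟ᵇ_)
open import Data.Empty using (⊥)
open import Data.Fin.Base using (Fin; zero; suc; toℕ; opposite; pred; combine; quotient; remainder; _↑ˡ_; _↑ʳ_)
open import Data.Fin.Patterns using (0F; 1F; 2F; 3F; 4F; 5F; 6F; 7F; 8F)
open import Data.Fin.Permutation using (permutation)
open import Data.Fin.Properties using (all?; any?; toℕ-injective; toℕ-inject₁; remQuot-combine; combine-remQuot) renaming (_≟_ to _≟ᶠ_)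
open import Data.Fin.Subset using (Subset; _∈_; ∣_∣)
open import Data.Fin.Subset.Properties using (x∈p∩q⁻)
open import Data.Maybe.Base using (Maybe; just; nothing)
import Data.Maybe.Properties as Maybe
open import Data.Nat using (ℕ; zero; suc; _+_; _*_; _/_; _≤_; _≤?_; z≤n; NonZero)
open import Data.Nat.DivMod using (m*n/n≡m; /-monoˡ-≤)
open import Data.Nat.GeneralisedArithmetic using (fold)
open import Data.Nat.Properties using (_≟_; +-0-commutativeMonoid; +-assoc; +-comm; +-mono-≤; *-comm; ≤-trans; ≤-reflexive; <-irrefl; ≰⇒>; m≤m+n; suc-injective; m≤n⇒∃[o]m+o≡n; module ≤-Reasoning)
open import Data.Nat.Tactic.RingSolver using (solve-∀)
open import Data.Product.Base using (∃-syntax; _×_; _,_; proj₁; proj₂)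
import Data.Product.Properties as Product
open import Data.Sum.Base using (_⊎_; inj₁; inj₂)
open import Data.Vec.Base using (Vec; []; _∷_; lookup; tabulate)
open import Data.Vec.Properties using (lookup∘tabulate; []=⇒lookup; lookup⇒[]=)
open import Data.Vec.Properties.WithK using ([]=-irrelevant)
open import Function.Base using (_∘_)
open import Function.Bundles using (mk↔ₛ′)
open import Function.Properties.Inverse using (↔⇒⤖)
import Relation.Binary.Construct.Add.Supremum.NonStrict as Supremum
open import Relation.Binary.Definitions using (Decidable)
open import Relation.Binary.PropositionalEquality using (_≡_; _≢_; refl; sym; trans; cong; cong₂; subst; subst₂; module ≡-Reasoning)
open import Relation.Nullary using (Dec; yes; no; contradiction; _×-dec_; _⊎-dec_; _→-dec_; ¬?)
open import Relation.Nullary.Construct.Add.Supremum using ([_]; ⊤⁺)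
open import Relation.Nullary.Decidable using (from-yes; map′)

open Algebra.Properties.CommutativeMonoid.Sum +-0-commutativeMonoid
  using (sum; sum-syntax; sum-cong-≗; sum-permute; ∑-comm)

-- Swap sets in arbitrary graphs

swapNumber≤ : ∀ {N} {G : Graph N} {D b} → IsSwapSet G D → ∣ D ∣ ≤ b → DDₘ G ≤⁺ [ b ]
swapNumber≤ {G = G} {D} s le with swapNumber G
... | [ k ] , _ , min = Supremum.[ ≤-trans (min D s) le ]
... | ⊤⁺ , none = contradiction s (none D)

∈-tabulate⁺ : ∀ {N} (f : Fin N → Bool) {v} → f v ≡ true → v ∈ tabulate f
∈-tabulate⁺ f {v} e = lookup⇒[]= v _ (trans (lookup∘tabulate f v) e)

∈-tabulate⁻ : ∀ {N} (f : Fin N → Bool) {v} → v ∈ tabulate f → f v ≡ true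
∈-tabulate⁻ f {v} p = trans (sym (lookup∘tabulate f v)) ([]=⇒lookup p)

𝟙 : Bool → ℕ
𝟙 true  = 1
𝟙 false = 0

∣tabulate∣ : ∀ {N} (f : Fin N → Bool) → ∣ tabulate f ∣ ≡ ∑[ v < N ] 𝟙 (f v)
∣tabulate∣ {zero}  f = refl
∣tabulate∣ {suc N} f with f zero
... | true  = cong suc (∣tabulate∣ (f ∘ suc))
... | false = ∣tabulate∣ (f ∘ suc)

module _ {N} (G : Graph N) (S : Bool → Fin N → Bool) (π : Fin N → Fin N)
  (π-involutive : ∀ v → π (π v) ≡ v)
  (π-swaps      : ∀ a v → S a (π v) ≡ S (not a) v)
  (π-adjacent   : ∀ v → S true v ≡ true → Adj G v (π v))
  (disjoint     : ∀ v → S true v ≡ true → S false v ≡ true → ⊥)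
  (dominating   : ∀ a v → S a v ≡ true ⊎ ∃[ u ] S a u ≡ true × Adj G u v)
  where

  -- Since `π` permutes all vertices and exchanges the two characteristic functions, reindexing a
  -- sum along it equates the cardinalities, and its restriction is the matching.
  involution⇒swapSet : IsSwapSet G (tabulate (S true))
  involution⇒swapSet = isDominating true , tabulate (S false) , isDominating false
    , (λ (v , p) → let q , r = x∈p∩q⁻ (tabulate (S true)) (tabulate (S false)) p
                   in disjoint v (∈-tabulate⁻ (S true) q) (∈-tabulate⁻ (S false) r))
    , card , ↔⇒⤖ (mk↔ₛ′ to from (λ (v , _) → Elem-≡ (π-involutive v)) (λ (v , _) → Elem-≡ (π-involutive v)))
    , λ (v , p) → π-adjacent v (∈-tabulate⁻ (S true) p)
    where
    isDominating : ∀ a → IsDominating G (tabulate (S a))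
    isDominating a v with dominating a v
    ... | inj₁ e           = inj₁ (∈-tabulate⁺ (S a) e)
    ... | inj₂ (u , e , q) = inj₂ (u , ∈-tabulate⁺ (S a) e , q)

    card : ∣ tabulate (S true) ∣ ≡ ∣ tabulate (S false) ∣
    card = begin
      ∣ tabulate (S true) ∣          ≡⟨ ∣tabulate∣ (S true) ⟩
      ∑[ v < N ] 𝟙 (S true v)        ≡⟨ sum-permute (𝟙 ∘ S true) (permutation π π π-involutive π-involutive) ⟩
      ∑[ v < N ] 𝟙 (S true (π v))    ≡⟨ sum-cong-≗ (λ v → cong 𝟙 (π-swaps true v)) ⟩
      ∑[ v < N ] 𝟙 (S false v)       ≡⟨ ∣tabulate∣ (S false) ⟨
      ∣ tabulate (S false) ∣         ∎
      where open ≡-Reasoning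

    Elem-≡ : ∀ {D} {x y : Elem G D} → proj₁ x ≡ proj₁ y → x ≡ y
    Elem-≡ {x = x , p} {_ , q} refl = cong (x ,_) ([]=-irrelevant p q)

    to : Elem G (tabulate (S true)) → Elem G (tabulate (S false))
    to (v , p) = π v , ∈-tabulate⁺ (S false) (trans (π-swaps false v) (∈-tabulate⁻ (S true) p))

    from : Elem G (tabulate (S false)) → Elem G (tabulate (S true))
    from (v , p) = π v , ∈-tabulate⁺ (S true) (trans (π-swaps true v) (∈-tabulate⁻ (S false) p))

-- Finite sums

∑-↑ : ∀ a {b} (f : Fin (a + b) → ℕ) →
  sum f ≡ ∑[ i < a ] f (i ↑ˡ b) + ∑[ i < b ] f (a ↑ʳ i)
∑-↑ zero    f = refl
∑-↑ (suc a) f = trans (cong (f zero +_) (∑-↑ a (f ∘ suc))) (sym (+-assoc (f zero) _ _))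

∑-combine : ∀ m {n} (f : Fin (m * n) → ℕ) →
  sum f ≡ ∑[ x < m ] ∑[ y < n ] f (combine x y)
∑-combine zero        f = refl
∑-combine (suc m) {n} f = trans (∑-↑ n f) (cong (∑[ y < n ] f (y ↑ˡ (m * n)) +_) (∑-combine m (f ∘ (n ↑ʳ_))))

*-≤-∑ : ∀ {n b} (f : Fin n → ℕ) → (∀ i → b ≤ f i) → n * b ≤ sum f
*-≤-∑ {zero}  f le = z≤n
*-≤-∑ {suc n} f le = +-mono-≤ (le zero) (*-≤-∑ (f ∘ suc) (le ∘ suc))

∑≤⇒∃≤average : ∀ {n b} .{{_ : NonZero n}} (f : Fin n → ℕ) → sum f ≤ b → ∃[ i ] f i ≤ b / n
∑≤⇒∃≤average {n} {b} f le with any? (λ i → f i ≤? b / n)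
... | yes found = found
-- If every term exceeded `b / n`, the sum would be at least `n * suc (b / n)`; dividing by `n`
-- gives `b / n < b / n`.
... | no ¬found = contradiction (begin-strict
    b / n                <⟨ ≤-reflexive (sym (m*n/n≡m (suc (b / n)) n)) ⟩
    suc (b / n) * n / n  ≡⟨ cong (_/ n) (*-comm (suc (b / n)) n) ⟩
    n * suc (b / n) / n  ≤⟨ /-monoˡ-≤ n (≤-trans (*-≤-∑ f λ i → ≰⇒> (¬found ∘ (i ,_))) le) ⟩
    b / n                ∎) (<-irrefl refl)
  where open ≤-Reasoning

-- Positions on a path

Zone Residue : Set
Zone    = Fin 9
Residue = Fin 5

-- Here `k` counts the middle vertices, which all share zone 4; only the last four are told apart.
beyond : ∀ k → Fin (k + 4) → Zone
beyond zero    i       = 5 ↑ʳ i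
beyond (suc k) zero    = 4F
beyond (suc k) (suc i) = beyond k i

-- The zones 0-3 and 5-8 are the first and the last four vertices of a path.
zone : ∀ k → Fin (4 + (k + 4)) → Zone
zone k 0F = 0F
zone k 1F = 1F
zone k 2F = 2F
zone k 3F = 3F
zone k (suc (suc (suc (suc i)))) = beyond k i

-- The zones of consecutive vertices for any `k`: 4 follows 4 when `k` is at least 2, and 5 follows
-- 3 when `k` is 0. Checks over `Step` thus cover all lengths at once.
Step : Zone → Zone → Set
Step t t′ = suc (toℕ t) ≡ toℕ t′ ⊎ (t ≡ 4F × t′ ≡ 4F) ⊎ (t ≡ 3F × t′ ≡ 5F)

step? : Decidable Step
step? t t′ = (suc (toℕ t) ≟ toℕ t′)
  ⊎-dec ((t ≟ᶠ 4F) ×-dec (t′ ≟ᶠ 4F)) ⊎-dec ((t ≟ᶠ 3F) ×-dec (t′ ≟ᶠ 5F))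

zone-step : ∀ k {i j} → suc (toℕ i) ≡ toℕ j → Step (zone k i) (zone k j)
zone-step k {0F} {1F} e = inj₁ refl
zone-step k {1F} {2F} e = inj₁ refl
zone-step k {2F} {3F} e = inj₁ refl
zone-step zero    {3F} {4F} e = inj₂ (inj₂ (refl , refl))
zone-step (suc k) {3F} {4F} e = inj₁ refl
zone-step k {suc (suc (suc (suc i)))} {suc (suc (suc (suc j)))} e =
  beyond-step k (suc-injective (suc-injective (suc-injective (suc-injective e))))
  where
  beyond-step : ∀ k {i j} → suc (toℕ i) ≡ toℕ j → Step (beyond k i) (beyond k j)
  beyond-step zero    {i} {j} e = inj₁ (cong (5 +_) e)
  beyond-step (suc zero)    {zero} {1F} e = inj₁ refl
  beyond-step (suc (suc k)) {zero} {1F} e = inj₂ (inj₁ (refl , refl))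
  beyond-step (suc k) {suc i} {suc j} e = beyond-step k (suc-injective e)

zone-last : ∀ k i → suc (toℕ i) ≡ 4 + (k + 4) → zone k i ≡ 8F
zone-last zero    3F ()
zone-last (suc k) 3F ()
zone-last k (suc (suc (suc (suc i)))) e =
  beyond-last k i (suc-injective (suc-injective (suc-injective (suc-injective e))))
  where
  beyond-last : ∀ k i → suc (toℕ i) ≡ k + 4 → beyond k i ≡ 8F
  beyond-last zero          3F      e = refl
  beyond-last (suc zero)    zero    ()
  beyond-last (suc (suc k)) zero    ()
  beyond-last (suc k)       (suc i) e = beyond-last k i (suc-injective e)

next : ∀ {n} → Fin n → Fin n
-- The last vertex is its own successor, which keeps `next` total; `toℕ-next` excludes it by its
-- zone.
next {suc zero}    zero    = zero
next {suc (suc n)} zero    = suc zero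
next               (suc i) = suc (next i)

next-unique : ∀ {n} {i j : Fin n} → suc (toℕ i) ≡ toℕ j → next i ≡ j
next-unique {suc (suc n)} {zero}  {1F}    e = refl
next-unique               {i = suc i} {suc j} e = cong suc (next-unique (suc-injective e))

pred-unique : ∀ {n} {i j : Fin n} → suc (toℕ i) ≡ toℕ j → pred j ≡ i
pred-unique {j = suc j} e = toℕ-injective (trans (toℕ-inject₁ j) (sym (suc-injective e)))

last∨next : ∀ {n} (i : Fin n) → suc (toℕ i) ≡ n ⊎ suc (toℕ i) ≡ toℕ (next i)
last∨next {suc zero}    zero = inj₁ refl
last∨next {suc (suc n)} zero = inj₂ refl
last∨next (suc i) with last∨next i
... | inj₁ e = inj₁ (cong suc e)
... | inj₂ e = inj₂ (cong suc e)

toℕ-next : ∀ {k i} → zone k i ≢ 8F → suc (toℕ i) ≡ toℕ (next i)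
toℕ-next {k} {i} i≢last with last∨next i
... | inj₁ e = contradiction (zone-last k i e) i≢last
... | inj₂ e = e

toℕ-pred : ∀ {k i} → zone k i ≢ 0F → suc (toℕ (pred i)) ≡ toℕ i
toℕ-pred {i = zero}  i≢first = contradiction refl i≢first
toℕ-pred {i = suc i} i≢first = cong suc (toℕ-inject₁ i)

-- Makes a sum over a path of arbitrary length linear in `k`, in the shape to which `sum` unfolds.
∑-zone : ∀ k (g : Zone → ℕ) → ∑[ i < 4 + (k + 4) ] g (zone k i) ≡
  g 0F + (g 1F + (g 2F + (g 3F + (k * g 4F + (g 5F + (g 6F + (g 7F + (g 8F + 0))))))))
∑-zone k g = cong (λ s → g 0F + (g 1F + (g 2F + (g 3F + s)))) (∑-beyond k)
  where
  ∑-beyond : ∀ k → ∑[ i < k + 4 ] g (beyond k i) ≡ k * g 4F + (g 5F + (g 6F + (g 7F + (g 8F + 0))))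
  ∑-beyond zero    = refl
  ∑-beyond (suc k) = trans (cong (g 4F +_) (∑-beyond k)) (sym (+-assoc (g 4F) (k * g 4F) _))

-- Cell contents

rot : Residue → Residue
rot 0F = 1F
rot 1F = 2F
rot 2F = 3F
rot 3F = 4F
rot 4F = 0F

∑-rot : ∀ (f : Residue → ℕ) → ∑[ ρ < 5 ] f (rot ρ) ≡ ∑[ ρ < 5 ] f ρ
∑-rot f = rotate (f 0F) (f 1F) (f 2F) (f 3F) (f 4F)
  where
  rotate : ∀ a b c d e → b + (c + (d + (e + (a + 0)))) ≡ a + (b + (c + (d + (e + 0))))
  rotate = solve-∀

-- The first component tells D (true) from E, the second whether the other half of the
-- domino lies to the right (true) or to the left.
Cell : Set
Cell = Maybe (Bool × Bool)

pattern D→ = just (true  , true)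
pattern D← = just (true  , false)
pattern E→ = just (false , true)
pattern E← = just (false , false)
pattern ∙  = nothing

_≟ᶜ_ : (c d : Cell) → Dec (c ≡ d)
_≟ᶜ_ = Maybe.≡-dec (Product.≡-dec _≟ᵇ_ _≟ᵇ_)

has : Bool → Cell → Bool
has a (just (true  , _)) = a
has a (just (false , _)) = not a
has a nothing            = false

-- This is the other half of the same domino. It is also the effect of a half-turn, which reverses
-- directions and exchanges D with E.
mate : Cell → Cell
mate (just (a , d)) = just (not a , not d)
mate nothing        = nothing

-- The contents, indexed by residue, of a cell of a row that is not a border row.
-- In zones 2-6 nothing changes; in zones 0 and 1 the dominoes starting at x = -2 and x = -1
-- have moved to x = 0 with their halves exchanged, and similarly on the right.
inner : Zone → Vec Cell 5
inner 0F = D→ ∷ E→ ∷ E→ ∷ ∙  ∷ ∙  ∷ []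
inner 1F = D→ ∷ E← ∷ D← ∷ D← ∷ ∙  ∷ []
inner 7F = D→ ∷ E← ∷ ∙  ∷ E→ ∷ E→ ∷ []
inner 8F = D← ∷ E← ∷ ∙  ∷ ∙  ∷ D← ∷ []
inner _  = D→ ∷ E← ∷ ∙  ∷ ∙  ∷ ∙  ∷ []

-- The row y = 0 also receives the dominoes of the row y = -1, at residues 2 and 3.
outer : Zone → Vec Cell 5
outer 0F = D→ ∷ E→ ∷ E→ ∷ E→ ∷ ∙  ∷ []
outer 1F = D→ ∷ E← ∷ D← ∷ D← ∷ D← ∷ []
outer 2F = D→ ∷ E← ∷ D→ ∷ D→ ∷ ∙  ∷ []
outer 3F = D→ ∷ E← ∷ D→ ∷ E← ∷ E← ∷ []
outer 6F = D→ ∷ E← ∷ ∙  ∷ E← ∷ ∙  ∷ []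
outer 7F = D→ ∷ E← ∷ D→ ∷ D→ ∷ E→ ∷ []
outer 8F = D← ∷ E← ∷ ∙  ∷ E← ∷ E← ∷ []
outer _  = D→ ∷ E← ∷ D→ ∷ E← ∷ ∙  ∷ []

-- The row y = n - 1 is obtained from the row y = 0 by a half-turn, which exchanges D and E
-- and sends the residue ρ to 1 - ρ.
cell : Zone → Zone → Residue → Cell
cell t 0F ρ = lookup (outer t) ρ
cell t 8F ρ = mate (lookup (outer (opposite t)) (rot (rot (opposite ρ))))
cell t _  ρ = lookup (inner t) ρ

-- Local checks on the tables

allᵇ? : ∀ {Q : Bool → Set} → (∀ a → Dec (Q a)) → Dec (∀ a → Q a)
allᵇ? Q? = map′ (λ (t , f) → λ { true → t ; false → f }) (λ q → q true , q false)
  (Q? true ×-dec Q? false)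

-- A local certificate that the predecessor or the successor on a line lies in the set `f`, where
-- `s` is the change of residue per step. A zone does not determine the adjacent zone, so all
-- admissible ones are required; the conditions on `t` ensure that the neighbour exists.
Neighbour : (Residue → Residue) → (Zone → Residue → Bool) → Zone → Residue → Set
Neighbour s f t ρ =
    (t ≢ 0F × ∀ t′ ρ′ → Step t′ t → s ρ′ ≡ ρ → f t′ ρ′ ≡ true)
  ⊎ (t ≢ 8F × ∀ t′ → Step t t′ → f t′ (s ρ) ≡ true)

neighbour? : ∀ s f t ρ → Dec (Neighbour s f t ρ)
neighbour? s f t ρ =
  (¬? (t ≟ᶠ 0F) ×-dec all? λ t′ → all? λ ρ′ → step? t′ t →-dec ((s ρ′ ≟ᶠ ρ) →-dec (f t′ ρ′ ≟ᵇ true)))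
  ⊎-dec (¬? (t ≟ᶠ 8F) ×-dec all? λ t′ → step? t t′ →-dec (f t′ (s ρ) ≟ᵇ true))

-- Opaque, since unfolding the finite checks is expensive.
abstract

  -- Together with `left-mate` this is coherence of the tables: no domino leaves the grid, and the
  -- adjacent cell holds the matching half.
  right-mate : ∀ t u ρ a → cell t u ρ ≡ just (a , true) →
    t ≢ 8F × (∀ t′ → Step t t′ → cell t′ u (rot ρ) ≡ just (not a , false))
  right-mate = from-yes (all? λ t → all? λ u → all? λ ρ → allᵇ? λ a →
    (cell t u ρ ≟ᶜ just (a , true)) →-dec (¬? (t ≟ᶠ 8F) ×-dec
    (all? λ t′ → step? t t′ →-dec (cell t′ u (rot ρ) ≟ᶜ just (not a , false)))))

  left-mate : ∀ t u ρ a → cell t u ρ ≡ just (a , false) →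
    t ≢ 0F × (∀ t′ ρ′ → Step t′ t → rot ρ′ ≡ ρ → cell t′ u ρ′ ≡ just (not a , true))
  left-mate = from-yes (all? λ t → all? λ u → all? λ ρ → allᵇ? λ a →
    (cell t u ρ ≟ᶜ just (a , false)) →-dec (¬? (t ≟ᶠ 0F) ×-dec
    (all? λ t′ → all? λ ρ′ → step? t′ t →-dec ((rot ρ′ ≟ᶠ ρ) →-dec
      (cell t′ u ρ′ ≟ᶜ just (not a , true))))))

  -- A neighbour is sought along the row, where residues change by 1, and then along the column,
  -- where they change by 2.
  dominated : ∀ t u ρ a → has a (cell t u ρ) ≡ true
    ⊎ Neighbour rot (λ t → has a ∘ cell t u) t ρ
    ⊎ Neighbour (rot ∘ rot) (λ u → has a ∘ cell t u) u ρ
  dominated = from-yes (all? λ t → all? λ u → all? λ ρ → allᵇ? λ a →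
    (has a (cell t u ρ) ≟ᵇ true)
    ⊎-dec neighbour? rot (λ t → has a ∘ cell t u) t ρ
    ⊎-dec neighbour? (rot ∘ rot) (λ u → has a ∘ cell t u) u ρ)

neighbour : ∀ {k s f} (r : Fin (4 + (k + 4)) → Residue) →
  (∀ {i j} → suc (toℕ i) ≡ toℕ j → r j ≡ s (r i)) →
  ∀ {i} → Neighbour s f (zone k i) (r i) →
  ∃[ j ] f (zone k j) (r j) ≡ true × Adj (P (4 + (k + 4))) j i
neighbour {k} r r-step {i} (inj₁ (i≢first , h)) = pred i , h _ _ (zone-step k e) (sym (r-step e)) , inj₁ e
  where
  e : suc (toℕ (pred i)) ≡ toℕ i
  e = toℕ-pred i≢first
neighbour {k} {f = f} r r-step {i} (inj₂ (i≢last , h)) =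
  next i , trans (cong (f _) (r-step e)) (h _ (zone-step k e)) , inj₂ e
  where
  e : suc (toℕ i) ≡ toℕ (next i)
  e = toℕ-next i≢last

has-disjoint : ∀ c → has true c ≡ true → has false c ≡ true → ⊥
has-disjoint (just (true , _)) _ ()

has⇒≢nothing : ∀ {c} → has true c ≡ true → c ≢ nothing
has⇒≢nothing () refl

has-mate : ∀ a c → has a (mate c) ≡ has (not a) c
has-mate a (just (true  , _)) = refl
has-mate true  (just (false , _)) = refl
has-mate false (just (false , _)) = refl
has-mate a nothing = refl

fold-comm : ∀ {A : Set} (z : A) (s : A → A) n → fold (s z) s n ≡ s (fold z s n)
fold-comm z s zero    = refl
fold-comm z s (suc n) = cong s (fold-comm z s n)

-- Invariance of sums stands in for bijectivity of `s` and passes to its iterates.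
∑-fold : ∀ {s : Residue → Residue} → (∀ f → ∑[ ρ < 5 ] f (s ρ) ≡ ∑[ ρ < 5 ] f ρ) →
  ∀ n (f : Residue → ℕ) → ∑[ ρ < 5 ] f (fold ρ s n) ≡ ∑[ ρ < 5 ] f ρ
∑-fold     inv zero    f = refl
∑-fold {s} inv (suc n) f = trans (∑-fold inv n (f ∘ s)) (inv f)

-- The grid

module Grid (k l : ℕ) where

  m n : ℕ
  m = 4 + (k + 4)
  n = 4 + (l + 4)

  G : Graph (m * n)
  G = P m □ P n

  column : Fin (m * n) → Fin m
  column = quotient n

  row : Fin (m * n) → Fin n
  row = remainder {m} n

  column-combine : ∀ x (y : Fin n) → column (combine x y) ≡ x
  column-combine x y = cong proj₁ (remQuot-combine {m} {n} x y)

  row-combine : ∀ (x : Fin m) y → row (combine x y) ≡ y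
  row-combine x y = cong proj₂ (remQuot-combine {m} {n} x y)

  -- This is `c + 2y + x` modulo 5, since `rot` adds 1.
  residue : Residue → Fin m → Fin n → Residue
  residue c x y = fold (fold c (rot ∘ rot) (toℕ y)) rot (toℕ x)

  residue-stepˣ : ∀ c y {x x′} → suc (toℕ x) ≡ toℕ x′ → residue c x′ y ≡ rot (residue c x y)
  residue-stepˣ c y e = cong (fold _ rot) (sym e)

  residue-stepʸ : ∀ c x {y y′} → suc (toℕ y) ≡ toℕ y′ → residue c x y′ ≡ rot (rot (residue c x y))
  residue-stepʸ c x {y} {y′} e = begin
    residue c x y′                 ≡⟨ cong (λ i → fold (fold c (rot ∘ rot) i) rot (toℕ x)) e ⟨
    fold (rot (rot z)) rot (toℕ x) ≡⟨ fold-comm (rot z) rot (toℕ x) ⟩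
    rot (fold (rot z) rot (toℕ x)) ≡⟨ cong rot (fold-comm z rot (toℕ x)) ⟩
    rot (rot (residue c x y))      ∎
    where
    open ≡-Reasoning
    z : Residue
    z = fold c (rot ∘ rot) (toℕ y)

  -- The swap set of one offset

  module Offset (c : Residue) where

    content : Fin m → Fin n → Cell
    content x y = cell (zone k x) (zone l y) (residue c x y)

    shift : Cell → Fin m → Fin m
    shift (just (_ , true))  = next
    shift (just (_ , false)) = pred
    shift nothing            x = x

    partner : Fin m → Fin n → Fin m
    partner x y = shift (content x y) x

    -- All three claims need the same case split on the content. The second uses
    -- `mate (content x y)` in place of the equal content of the partner, so that `shift` reduces in
    -- each case.
    content-partner : ∀ x y → content (partner x y) y ≡ mate (content x y)
                            × shift (mate (content x y)) (partner x y) ≡ x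
                            × (content x y ≢ nothing → Adj (P m) x (partner x y))
    content-partner x y with content x y in eq
    ... | nothing = eq , refl , contradiction refl
    ... | just (a , true) =
      let x≢last , h = right-mate _ (zone l y) _ a eq
          e = toℕ-next x≢last
      in trans (cong (cell _ (zone l y)) (residue-stepˣ c y e)) (h _ (zone-step k e))
       , pred-unique e , λ _ → inj₁ e
    ... | just (a , false) =
      let x≢first , h = left-mate _ (zone l y) _ a eq
          e = toℕ-pred x≢first
      in h _ _ (zone-step k e) (sym (residue-stepˣ c y e)) , next-unique e , λ _ → inj₂ e

    partner-involutive : ∀ x y → partner (partner x y) y ≡ x
    partner-involutive x y = let e , i , _ = content-partner x y in
      trans (cong (λ s → shift s (partner x y)) e) i

    contentᵥ : Fin (m * n) → Cell
    contentᵥ v = content (column v) (row v)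

    contentᵥ-combine : ∀ x y → contentᵥ (combine x y) ≡ content x y
    contentᵥ-combine x y = cong₂ content (column-combine x y) (row-combine x y)

    S : Bool → Fin (m * n) → Bool
    S a v = has a (contentᵥ v)

    π : Fin (m * n) → Fin (m * n)
    π v = combine (partner (column v) (row v)) (row v)

    π-involutive : ∀ v → π (π v) ≡ v
    π-involutive v = trans (cong₂ combine
      (trans (cong₂ partner (column-combine x′ y) (row-combine x′ y)) (partner-involutive x y))
      (row-combine x′ y)) (combine-remQuot {m} n v)
      where
      x = column v
      y = row v
      x′ = partner x y

    π-swaps : ∀ a v → S a (π v) ≡ S (not a) v
    π-swaps a v = trans (cong (has a) (trans (contentᵥ-combine (partner (column v) (row v)) (row v))
      (proj₁ (content-partner (column v) (row v))))) (has-mate a (contentᵥ v))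

    π-adjacent : ∀ v → S true v ≡ true → Adj G v (π v)
    π-adjacent v s = inj₂
      ( subst (Adj (P m) (column v)) (sym (column-combine _ (row v)))
          (proj₂ (proj₂ (content-partner (column v) (row v))) (has⇒≢nothing s))
      , sym (row-combine (partner (column v) (row v)) (row v)))

    dominating : ∀ a v → S a v ≡ true ⊎ ∃[ u ] S a u ≡ true × Adj G u v
    dominating a v with dominated (zone k (column v)) (zone l (row v)) (residue c (column v) (row v)) a
    ... | inj₁ s = inj₁ s
    ... | inj₂ (inj₁ h) =
      let x , s , adj = neighbour (λ x → residue c x (row v)) (residue-stepˣ c (row v)) h
      in inj₂ (combine x (row v) , trans (cong (has a) (contentᵥ-combine x (row v))) s
        , inj₂ (subst (λ x → Adj (P m) x (column v)) (sym (column-combine x (row v))) adj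
               , row-combine x (row v)))
    ... | inj₂ (inj₂ h) =
      let y , s , adj = neighbour (residue c (column v)) (residue-stepʸ c (column v)) h
      in inj₂ (combine (column v) y , trans (cong (has a) (contentᵥ-combine (column v) y)) s
        , inj₁ (column-combine (column v) y
               , subst (λ y → Adj (P n) y (row v)) (sym (row-combine (column v) y)) adj))

    D : Subset (m * n)
    D = tabulate (S true)

    isSwapSet : IsSwapSet G D
    isSwapSet = involution⇒swapSet G S π π-involutive π-swaps π-adjacent
      (λ v → has-disjoint (contentᵥ v)) dominating

    ∣D∣ : ∣ D ∣ ≡ ∑[ x < m ] ∑[ y < n ] 𝟙 (has true (content x y))
    ∣D∣ = begin
      ∣ D ∣                                              ≡⟨ ∣tabulate∣ (S true) ⟩
      ∑[ v < m * n ] 𝟙 (S true v)                       ≡⟨ ∑-combine m {n} (𝟙 ∘ S true) ⟩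
      ∑[ x < m ] ∑[ y < n ] 𝟙 (S true (combine x y))    ≡⟨ sum-cong-≗ (λ x → sum-cong-≗ (𝟙-content x)) ⟩
      ∑[ x < m ] ∑[ y < n ] 𝟙 (has true (content x y))  ∎
      where
      open ≡-Reasoning
      𝟙-content : ∀ x y → 𝟙 (S true (combine x y)) ≡ 𝟙 (has true (content x y))
      𝟙-content x y = cong (𝟙 ∘ has true) (contentᵥ-combine x y)

  -- Counting over the five offsets

  open Offset

  weight : Zone → Zone → ℕ
  weight t u = ∑[ ρ < 5 ] 𝟙 (has true (cell t u ρ))

  -- For a fixed cell the residue runs through all five classes as `c` does; the translations by `y`
  -- and then by `x` are removed from the sum.
  ∑-offsets : ∀ x y → ∑[ c < 5 ] 𝟙 (has true (content c x y)) ≡ weight (zone k x) (zone l y)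
  ∑-offsets x y = trans
    (∑-fold (λ f → trans (∑-rot (f ∘ rot)) (∑-rot f)) (toℕ y) (λ z → h (fold z rot (toℕ x))))
    (∑-fold ∑-rot (toℕ x) h)
    where
    h : Residue → ℕ
    h ρ = 𝟙 (has true (cell (zone k x) (zone l y) ρ))

  -- Over the five offsets, each of the `n - 2` inner rows holds `m + 3` dominoes and each border
  -- row `2(m + 3) - 5`, hence the 10.
  ∑∣D∣ : ∑[ c < 5 ] ∣ D c ∣ + 10 ≡ (n + 2) * (m + 3)
  ∑∣D∣ = trans (cong (_+ 10) (begin
    ∑[ c < 5 ] ∣ D c ∣
      ≡⟨ sum-cong-≗ ∣D∣ ⟩
    ∑[ c < 5 ] ∑[ x < m ] ∑[ y < n ] 𝟙 (has true (content c x y))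
      ≡⟨ ∑-comm (λ c x → ∑[ y < n ] 𝟙 (has true (content c x y))) ⟩
    ∑[ x < m ] ∑[ c < 5 ] ∑[ y < n ] 𝟙 (has true (content c x y))
      ≡⟨ sum-cong-≗ (λ x → ∑-comm λ c y → 𝟙 (has true (content c x y))) ⟩
    ∑[ x < m ] ∑[ y < n ] ∑[ c < 5 ] 𝟙 (has true (content c x y))
      ≡⟨ sum-cong-≗ (λ x → sum-cong-≗ (∑-offsets x)) ⟩
    ∑[ x < m ] ∑[ y < n ] weight (zone k x) (zone l y)
      ≡⟨ sum-cong-≗ (λ x → ∑-zone l (weight (zone k x))) ⟩
    ∑[ x < m ] weights (zone k x)
      ≡⟨ ∑-zone k weights ⟩
    weights 0F + (weights 1F + (weights 2F + (weights 3F + (k * weights 4F +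
      (weights 5F + (weights 6F + (weights 7F + (weights 8F + 0))))))))
      ∎)) (total k l)
    where
    open ≡-Reasoning
    weights : Zone → ℕ
    weights t = weight t 0F + (weight t 1F + (weight t 2F + (weight t 3F + (l * weight t 4F +
      (weight t 5F + (weight t 6F + (weight t 7F + (weight t 8F + 0))))))))
    -- The literals come from normalising weights 0F, …, weights 8F.
    total : ∀ k l →
      4 + (l * 1 + 6) + (13 + (l * 3 + 11) + (6 + (l * 1 + 5) + (5 + (l * 1 + 5) + (k * (5 + (l * 1 + 5)) +
      (5 + (l * 1 + 6) + (4 + (l * 1 + 4) + (6 + (l * 1 + 4) + (7 + (l * 2 + 9) + 0)))))))) + 10
      ≡ (4 + (l + 4) + 2) * (4 + (k + 4) + 3)
    total = solve-∀

  bound : DDₘ G ≤⁺ [ ((n + 2) * (m + 3)) / 5 ]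
  bound = let c , le = ∑≤⇒∃≤average (∣_∣ ∘ D) (≤-trans (m≤m+n _ 10) (≤-reflexive ∑∣D∣))
          in swapNumber≤ (isSwapSet c) le

theorem31 : (m n : ℕ) → n ≤ m → 8 ≤ n →
    DDₘ (P m □ P n) ≤⁺ [ ((n + 2) * (m + 3)) / 5 ]
theorem31 m n n≤m 8≤n = subst₂ (λ m n → DDₘ (P m □ P n) ≤⁺ [ ((n + 2) * (m + 3)) / 5 ])
  (proj₂ m′) (proj₂ n′) (Grid.bound (proj₁ m′) (proj₁ n′))
  where
  -- Eight is the least length with room for four distinguished vertices at either end.
  8≤⇒ : ∀ {n} → 8 ≤ n → ∃[ k ] 4 + (k + 4) ≡ n
  8≤⇒ le = let k , e = m≤n⇒∃[o]m+o≡n le in k , trans (cong (4 +_) (+-comm k 4)) e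
  m′ = 8≤⇒ (≤-trans 8≤n n≤m)
  n′ = 8≤⇒ 8≤n
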